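{- Let $G=(V,E)$ be a simple undirected graph that is not complete. Then (a) $\textnormal{conv}(X(G))\subseteq\mathbb{R}^{E^c}$ is full-dimensional, and (b) for every $f\in E^c$ the inequality $x_f\le 1$ is facet-defining for $\textnormal{conv}(X(G))$.
   Context: $E^c=\binom{V}{2}\setminus E$. For $x\in\{0,1\}^{E^c}$, $E(x)=\{f\in E^c:x_f=1\}$, and $X(G)=\{x\in\{0,1\}^{E^c}:(V,E\cup E(x))\text{ is chordal}\}$, where a graph is chordal if every cycle with at least four vertices has a chord (an edge joining two nonconsecutive vertices of the cycle). -}

module Defs where

open import Level using (0ℓ)
open import Data.Bool.Base using (Bool; true; if_then_else_)
import Data.Bool.Properties as Bool
open import Data.Fin.Base as Fin using (Fin; toℕ)
import Data.Fin.Properties as Fin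
open import Data.Integer.Base as ℤ using (ℤ; +_; _⊖_)
open import Data.List.Base as List using (List; filter; cartesianProduct; allFin; length)
open import Data.List.Membership.Propositional.Properties using (∈-filter⁻; ∈-lookup)
open import Data.Nat.Base as ℕ using (ℕ; suc)
open import Data.Nat.DivMod using (_mod_)
import Data.Nat.Properties as ℕ
open import Data.Product.Base using (∃; ∃-syntax; ∃₂; _×_; _,_; proj₁; proj₂)
open import Data.Product.Properties using (≡-dec)
open import Data.Rational.Base as ℚ using (ℚ; 0ℚ; 1ℚ; ½)
import Data.Rational.Properties as ℚ
open import Data.Rational.Solver using (module +-*-Solver)
open import Data.Sum.Base using (_⊎_; inj₁; inj₂; [_,_]′)
import Data.Sum.Base as Sum
open import Data.Vec.Functional using (Vector; foldr)
open import Function.Base using (_∘_)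
open import Function.Definitions using (Injective)
open import Relation.Binary.Core using (Rel)
open import Relation.Binary.Definitions using (Decidable; Symmetric; Irreflexive)
open import Relation.Binary.PropositionalEquality
  using (_≡_; refl; sym; trans; cong; subst)
open import Relation.Nullary using (¬_; Dec; does)
open import Relation.Nullary.Decidable using (_×-dec_; _⊎-dec_; ¬?)
open import Relation.Unary using (Pred; _∩_)

-- Reals are Cauchy sequences of rationals, not quotiented: the equality of
-- real numbers is _≈_ below, never _≡_.

Eventually : Pred (ℕ → Set) 0ℓ
Eventually P = ∃[ N ] (∀ n → N ℕ.≤ n → P n)

IsCauchy : Pred (ℕ → ℚ) 0ℓ
IsCauchy s = ∀ ε → 0ℚ ℚ.< ε →
  ∃[ N ] (∀ m n → N ℕ.≤ m → N ℕ.≤ n → ℚ.∣ s m ℚ.- s n ∣ ℚ.≤ ε)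

record ℝ : Set where
  constructor mkℝ
  field
    seq    : ℕ → ℚ
    cauchy : IsCauchy seq

open ℝ public

half : ∀ ε → ½ ℚ.* ε ℚ.+ ½ ℚ.* ε ≡ ε
half ε = trans (sym (ℚ.*-distribʳ-+ ε ½ ½)) (ℚ.*-identityˡ ε)

half-pos : ∀ ε → 0ℚ ℚ.< ε → 0ℚ ℚ.< ½ ℚ.* ε
half-pos ε ε>0 = ℚ.positive⁻¹ (½ ℚ.* ε) {{ℚ.pos*pos⇒pos ½ ε {{ℚ.positive ε>0}}}}

∣p∣+1-pos : ∀ p → 0ℚ ℚ.< ℚ.∣ p ∣ ℚ.+ 1ℚ
∣p∣+1-pos p = ℚ.+-mono-≤-< (ℚ.0≤∣p∣ p) (ℚ.positive⁻¹ 1ℚ)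

quotient : ∀ c ε → 0ℚ ℚ.< c → 0ℚ ℚ.< ε → ∃[ δ ] (0ℚ ℚ.< δ × c ℚ.* δ ≡ ε)
quotient c ε c>0 ε>0 = c⁻¹ ℚ.* ε ,
  ℚ.positive⁻¹ (c⁻¹ ℚ.* ε) {{ℚ.pos*pos⇒pos c⁻¹ {{ℚ.1/pos⇒pos c {{ℚ.positive c>0}}}} ε {{ℚ.positive ε>0}}}} ,
  trans (sym (ℚ.*-assoc c c⁻¹ ε))
    (trans (cong (ℚ._* ε) (ℚ.*-inverseʳ c {{c≢0}})) (ℚ.*-identityˡ ε))
  where
  c≢0 : ℚ.NonZero c
  c≢0 = ℚ.pos⇒nonZero c {{ℚ.positive c>0}}
  c⁻¹ : ℚ
  c⁻¹ = ℚ.1/_ c {{c≢0}}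

Bounded : (ℕ → ℚ) → Set
Bounded s = ∃[ B ] (0ℚ ℚ.< B × Eventually (λ n → ℚ.∣ s n ∣ ℚ.≤ B))

cauchy⇒bounded : ∀ s → IsCauchy s → Bounded s
cauchy⇒bounded s c with c 1ℚ (ℚ.positive⁻¹ 1ℚ)
... | N , near = ℚ.∣ s N ∣ ℚ.+ 1ℚ , ∣p∣+1-pos (s N) , N , bound
  where
  open ℚ.≤-Reasoning
  split : ∀ p q → p ≡ q ℚ.+ (p ℚ.- q)
  split = solve 2 (λ p q → p := q :+ (p :- q)) refl where open +-*-Solver
  bound : ∀ n → N ℕ.≤ n → ℚ.∣ s n ∣ ℚ.≤ ℚ.∣ s N ∣ ℚ.+ 1ℚ
  bound n N≤n = begin
    ℚ.∣ s n ∣                          ≡⟨ cong ℚ.∣_∣ (split (s n) (s N)) ⟩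
    ℚ.∣ s N ℚ.+ (s n ℚ.- s N) ∣        ≤⟨ ℚ.∣p+q∣≤∣p∣+∣q∣ (s N) (s n ℚ.- s N) ⟩
    ℚ.∣ s N ∣ ℚ.+ ℚ.∣ s n ℚ.- s N ∣    ≤⟨ ℚ.+-monoʳ-≤ ℚ.∣ s N ∣ (near n N N≤n ℕ.≤-refl) ⟩
    ℚ.∣ s N ∣ ℚ.+ 1ℚ                   ∎

+-cauchy : ∀ s t → IsCauchy s → IsCauchy t → IsCauchy (λ n → s n ℚ.+ t n)
+-cauchy s t cs ct ε ε>0
  with cs (½ ℚ.* ε) (half-pos ε ε>0) | ct (½ ℚ.* ε) (half-pos ε ε>0)
... | M , near-s | N , near-t = M ℕ.⊔ N , near
  where
  open ℚ.≤-Reasoning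
  regroup : ∀ a b c d → (a ℚ.+ b) ℚ.- (c ℚ.+ d) ≡ (a ℚ.- c) ℚ.+ (b ℚ.- d)
  regroup = solve 4 (λ a b c d → (a :+ b) :- (c :+ d) := (a :- c) :+ (b :- d)) refl
    where open +-*-Solver
  near : ∀ m n → M ℕ.⊔ N ℕ.≤ m → M ℕ.⊔ N ℕ.≤ n →
         ℚ.∣ (s m ℚ.+ t m) ℚ.- (s n ℚ.+ t n) ∣ ℚ.≤ ε
  near m n ≤m ≤n = begin
    ℚ.∣ (s m ℚ.+ t m) ℚ.- (s n ℚ.+ t n) ∣
      ≡⟨ cong ℚ.∣_∣ (regroup (s m) (t m) (s n) (t n)) ⟩
    ℚ.∣ (s m ℚ.- s n) ℚ.+ (t m ℚ.- t n) ∣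
      ≤⟨ ℚ.∣p+q∣≤∣p∣+∣q∣ (s m ℚ.- s n) (t m ℚ.- t n) ⟩
    ℚ.∣ s m ℚ.- s n ∣ ℚ.+ ℚ.∣ t m ℚ.- t n ∣
      ≤⟨ ℚ.+-mono-≤
           (near-s m n (ℕ.m⊔n≤o⇒m≤o M N ≤m) (ℕ.m⊔n≤o⇒m≤o M N ≤n))
           (near-t m n (ℕ.m⊔n≤o⇒n≤o M N ≤m) (ℕ.m⊔n≤o⇒n≤o M N ≤n)) ⟩
    ½ ℚ.* ε ℚ.+ ½ ℚ.* ε
      ≡⟨ half ε ⟩
    ε ∎

*-mono-∣∣ : ∀ p q {a b} → 0ℚ ℚ.< a → ℚ.∣ p ∣ ℚ.≤ a → ℚ.∣ q ∣ ℚ.≤ b →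
            ℚ.∣ p ℚ.* q ∣ ℚ.≤ a ℚ.* b
*-mono-∣∣ p q {a} {b} a>0 p≤a q≤b = begin
  ℚ.∣ p ℚ.* q ∣         ≡⟨ ℚ.∣p*q∣≡∣p∣*∣q∣ p q ⟩
  ℚ.∣ p ∣ ℚ.* ℚ.∣ q ∣   ≤⟨ ℚ.*-monoʳ-≤-nonNeg ℚ.∣ q ∣ {{ℚ.∣-∣-nonNeg q}} p≤a ⟩
  a ℚ.* ℚ.∣ q ∣         ≤⟨ ℚ.*-monoˡ-≤-nonNeg a {{ℚ.nonNegative (ℚ.<⇒≤ a>0)}} q≤b ⟩
  a ℚ.* b               ∎
  where open ℚ.≤-Reasoning

*-estimate : ∀ a b c d A B δ → 0ℚ ℚ.< A → 0ℚ ℚ.< B →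
  ℚ.∣ a ∣ ℚ.≤ A → ℚ.∣ d ∣ ℚ.≤ B → ℚ.∣ a ℚ.- c ∣ ℚ.≤ δ → ℚ.∣ b ℚ.- d ∣ ℚ.≤ δ →
  ℚ.∣ a ℚ.* b ℚ.- c ℚ.* d ∣ ℚ.≤ (A ℚ.+ B) ℚ.* δ
*-estimate a b c d A B δ A>0 B>0 a≤A d≤B a-c b-d = begin
  ℚ.∣ a ℚ.* b ℚ.- c ℚ.* d ∣
    ≡⟨ cong ℚ.∣_∣ (regroup a b c d) ⟩
  ℚ.∣ a ℚ.* (b ℚ.- d) ℚ.+ d ℚ.* (a ℚ.- c) ∣
    ≤⟨ ℚ.∣p+q∣≤∣p∣+∣q∣ (a ℚ.* (b ℚ.- d)) (d ℚ.* (a ℚ.- c)) ⟩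
  ℚ.∣ a ℚ.* (b ℚ.- d) ∣ ℚ.+ ℚ.∣ d ℚ.* (a ℚ.- c) ∣
    ≤⟨ ℚ.+-mono-≤ (*-mono-∣∣ a (b ℚ.- d) A>0 a≤A b-d) (*-mono-∣∣ d (a ℚ.- c) B>0 d≤B a-c) ⟩
  A ℚ.* δ ℚ.+ B ℚ.* δ
    ≡⟨ sym (ℚ.*-distribʳ-+ δ A B) ⟩
  (A ℚ.+ B) ℚ.* δ ∎
  where
  open ℚ.≤-Reasoning
  regroup : ∀ a b c d → a ℚ.* b ℚ.- c ℚ.* d ≡ a ℚ.* (b ℚ.- d) ℚ.+ d ℚ.* (a ℚ.- c)
  regroup = solve 4 (λ a b c d → a :* b :- c :* d := a :* (b :- d) :+ d :* (a :- c)) refl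
    where open +-*-Solver

⊔-split : ∀ a b m → a ℕ.⊔ b ℕ.≤ m → a ℕ.≤ m × b ℕ.≤ m
⊔-split a b m p = ℕ.m⊔n≤o⇒m≤o a b p , ℕ.m⊔n≤o⇒n≤o a b p

*-cauchy : ∀ s t → IsCauchy s → IsCauchy t → IsCauchy (λ n → s n ℚ.* t n)
*-cauchy s t cs ct ε ε>0 =
  let A , A>0 , L  , s≤A   = cauchy⇒bounded s cs
      B , B>0 , L′ , t≤B   = cauchy⇒bounded t ct
      δ , δ>0 , [A+B]δ≡ε   = quotient (A ℚ.+ B) ε (ℚ.+-mono-< A>0 B>0) ε>0
      K  , near-s          = cs δ δ>0
      K′ , near-t          = ct δ δ>0
  in (L ℕ.⊔ L′) ℕ.⊔ (K ℕ.⊔ K′) , λ m n ≤m ≤n →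
     let L≤m , _    = ⊔-split L L′ m (proj₁ (⊔-split (L ℕ.⊔ L′) (K ℕ.⊔ K′) m ≤m))
         K≤m , K′≤m = ⊔-split K K′ m (proj₂ (⊔-split (L ℕ.⊔ L′) (K ℕ.⊔ K′) m ≤m))
         _ , L′≤n   = ⊔-split L L′ n (proj₁ (⊔-split (L ℕ.⊔ L′) (K ℕ.⊔ K′) n ≤n))
         K≤n , K′≤n = ⊔-split K K′ n (proj₂ (⊔-split (L ℕ.⊔ L′) (K ℕ.⊔ K′) n ≤n))
     in subst (ℚ.∣ s m ℚ.* t m ℚ.- s n ℚ.* t n ∣ ℚ.≤_) [A+B]δ≡ε
          (*-estimate (s m) (t m) (s n) (t n) A B δ A>0 B>0
            (s≤A m L≤m) (t≤B n L′≤n) (near-s m n K≤m K≤n) (near-t m n K′≤m K′≤n))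

const-cauchy : ∀ q → IsCauchy (λ _ → q)
const-cauchy q ε ε>0 = 0 , λ _ _ _ _ → begin
  ℚ.∣ q ℚ.- q ∣  ≡⟨ cong ℚ.∣_∣ (ℚ.+-inverseʳ q) ⟩
  0ℚ             ≤⟨ ℚ.<⇒≤ ε>0 ⟩
  ε              ∎
  where open ℚ.≤-Reasoning

infixl 6 _+_
infixl 7 _*_
infix  4 _≈_ _≤_

fromℚ : ℚ → ℝ
fromℚ q = mkℝ (λ _ → q) (const-cauchy q)

0ℝ 1ℝ : ℝ
0ℝ = fromℚ 0ℚ
1ℝ = fromℚ 1ℚ

_+_ _*_ : ℝ → ℝ → ℝ
mkℝ s cs + mkℝ t ct = mkℝ (λ n → s n ℚ.+ t n) (+-cauchy s t cs ct)
mkℝ s cs * mkℝ t ct = mkℝ (λ n → s n ℚ.* t n) (*-cauchy s t cs ct)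

_≈_ _≤_ : Rel ℝ 0ℓ
x ≈ y = ∀ ε → 0ℚ ℚ.< ε → Eventually (λ n → ℚ.∣ seq x n ℚ.- seq y n ∣ ℚ.≤ ε)
x ≤ y = ∀ ε → 0ℚ ℚ.< ε → Eventually (λ n → seq x n ℚ.≤ seq y n ℚ.+ ε)

sum : ∀ {k} → Vector ℝ k → ℝ
sum = foldr _+_ 0ℝ

ℝ^ : ℕ → Set
ℝ^ m = Vector ℝ m

infix 4 _≋_
_≋_ : ∀ {m} → Rel (ℝ^ m) 0ℓ
x ≋ y = ∀ i → x i ≈ y i

linComb : ∀ {m k} → Vector ℝ k → Vector (ℝ^ m) k → ℝ^ m
linComb w p i = sum (λ j → w j * p j i)

⟨_,_⟩ : ∀ {m} → ℝ^ m → ℝ^ m → ℝ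
⟨ a , x ⟩ = sum (λ i → a i * x i)

conv : ∀ {m} → Pred (ℝ^ m) 0ℓ → Pred (ℝ^ m) 0ℓ
conv S x = ∃[ k ] ∃₂ λ (w : Vector ℝ k) (p : Vector (ℝ^ _) k) →
  (∀ j → S (p j)) × (∀ j → 0ℝ ≤ w j) × sum w ≈ 1ℝ × x ≋ linComb w p

AffinelyIndependent : ∀ {m k} → Vector (ℝ^ m) k → Set
AffinelyIndependent {m} {k} p = (w : Vector ℝ k) →
  sum w ≈ 0ℝ → linComb w p ≋ (λ _ → 0ℝ) → ∀ j → w j ≈ 0ℝ

HasIndependentPoints : ∀ {m} → Pred (ℝ^ m) 0ℓ → ℕ → Set
HasIndependentPoints P k = ∃ λ (p : Vector (ℝ^ _) k) →
  (∀ j → P (p j)) × AffinelyIndependent p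

-- One less than the largest number of affinely independent points
-- (so the empty set has dimension -1).
HasDimension : ∀ {m} → Pred (ℝ^ m) 0ℓ → ℤ → Set
HasDimension P d = ∃[ r ] (d ≡ r ⊖ 1 ×
  HasIndependentPoints P r × (∀ k → HasIndependentPoints P k → k ℕ.≤ r))

FullDimensional : ∀ {m} → Pred (ℝ^ m) 0ℓ → Set
FullDimensional {m} P = HasDimension P (+ m)

Valid : ∀ {m} → Pred (ℝ^ m) 0ℓ → ℝ^ m → ℝ → Set
Valid P a b = ∀ x → P x → ⟨ a , x ⟩ ≤ b

Hyperplane : ∀ {m} → ℝ^ m → ℝ → Pred (ℝ^ m) 0ℓ
Hyperplane a b x = ⟨ a , x ⟩ ≈ b

FacetDefining : ∀ {m} → Pred (ℝ^ m) 0ℓ → ℝ^ m → ℝ → Set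
FacetDefining P a b = Valid P a b ×
  ∃[ d ] (HasDimension P d × HasDimension (P ∩ Hyperplane a b) (d ℤ.- + 1))

bit : Bool → ℝ
bit b = if b then 1ℝ else 0ℝ

-- With this coefficient vector, ⟨ unit f , x ⟩ is the coordinate x f.
unit : ∀ {m} → Fin m → ℝ^ m
unit f g = bit (does (f Fin.≟ g))

record Graph (n : ℕ) : Set₁ where
  field
    Adj    : Rel (Fin n) 0ℓ
    adj?   : Decidable Adj
    symm   : Symmetric Adj
    irrefl : Irreflexive _≡_ Adj

open Graph

Complete : ∀ {n} → Graph n → Set
Complete G = ∀ u v → ¬ u ≡ v → Adj G u v

next : ∀ {k} → Fin (suc k) → Fin (suc k)
next {k} i = suc (toℕ i) mod suc k

Consecutive : ∀ {k} → Rel (Fin (suc k)) 0ℓ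
Consecutive i j = j ≡ next i ⊎ i ≡ next j

IsCycle : ∀ {n k} → Graph n → Vector (Fin n) (suc k) → Set
IsCycle {k = k} H c = 3 ℕ.≤ suc k × Injective _≡_ _≡_ c × (∀ i → Adj H (c i) (c (next i)))

HasChord : ∀ {n k} → Graph n → Vector (Fin n) (suc k) → Set
HasChord H c = ∃₂ λ i j → ¬ Consecutive i j × Adj H (c i) (c j)

Chordal : ∀ {n} → Graph n → Set
Chordal {n} H = ∀ {k} (c : Vector (Fin n) (suc k)) → 4 ℕ.≤ suc k → IsCycle H c → HasChord H c

module _ {n} (G : Graph n) where

  NonEdge : Pred (Fin n × Fin n) 0ℓ
  NonEdge (u , v) = u Fin.< v × ¬ Adj G u v

  nonEdge? : ∀ e → Dec (NonEdge e)
  nonEdge? (u , v) = (u Fin.<? v) ×-dec ¬? (adj? G u v)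

  -- Every 2-subset {u , v} outside E, listed once as the pair with u < v.
  Eᶜ : List (Fin n × Fin n)
  Eᶜ = filter nonEdge? (cartesianProduct (allFin n) (allFin n))

  -- The coordinates of {0,1}^Eᶜ and ℝ^Eᶜ are indexed by positions in Eᶜ.
  ∣Eᶜ∣ : ℕ
  ∣Eᶜ∣ = length Eᶜ

  Ends : Fin ∣Eᶜ∣ → Rel (Fin n) 0ℓ
  Ends f u v = List.lookup Eᶜ f ≡ (u , v) ⊎ List.lookup Eᶜ f ≡ (v , u)

  private
    ends? : ∀ f → Decidable (Ends f)
    ends? f u v = ≡-dec Fin._≟_ Fin._≟_ _ _ ⊎-dec ≡-dec Fin._≟_ Fin._≟_ _ _

    ends-irrefl : ∀ f {u v} → u ≡ v → ¬ Ends f u v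
    ends-irrefl f {u} refl e = Fin.<-irrefl refl
      (proj₁ (subst NonEdge ([ (λ p → p) , (λ p → p) ]′ e)
        (proj₂ (∈-filter⁻ nonEdge? {xs = cartesianProduct (allFin n) (allFin n)} (∈-lookup f)))))

  -- The graph (V , E ∪ E(x)).
  fill : Vector Bool ∣Eᶜ∣ → Graph n
  fill x = record
    { Adj    = λ u v → Adj G u v ⊎ ∃[ f ] (x f ≡ true × Ends f u v)
    ; adj?   = λ u v → adj? G u v ⊎-dec Fin.any? (λ f → (x f Bool.≟ true) ×-dec ends? f u v)
    ; symm   = Sum.map (symm G) (λ (f , xf , e) → f , xf , Sum.swap e)
    ; irrefl = λ u≡v → [ irrefl G u≡v , (λ (f , _ , e) → ends-irrefl f u≡v e) ]′
    }

  -- X(G) ⊆ {0,1}^Eᶜ, viewed in ℝ^Eᶜ.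
  X : Pred (ℝ^ ∣Eᶜ∣) 0ℓ
  X y = ∃ λ (x : Vector Bool ∣Eᶜ∣) → Chordal (fill x) × y ≋ (bit ∘ x)

-- The points 𝟙 and 𝟙 − e_g (g ∈ Eᶜ) lie in X(G), since a complete graph minus at
-- most one edge is chordal, and these ∣Eᶜ∣ + 1 points are affinely independent.
-- All of them but 𝟙 − e_f lie on the hyperplane x_f = 1. Conversely, k affinely
-- independent points in ℝᵐ satisfy k ≤ m + 1, and k ≤ m on a hyperplane x_f = 1,
-- because there the coordinate f already records the sum of the coefficients.
--
-- For the upper bounds, equality of reals is not decidable, but the goal k ≤ m is,
-- hence stable: Gaussian elimination may assume that an entry is zero once it has
-- been shown not to be apart from zero.

module Submission where

open import Algebra.Bundles using (CommutativeRing)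
open import Data.Bool.Base using (Bool; true; false; not)
import Data.Bool.Properties as Bool
open import Data.Fin.Base using (Fin; zero; suc; punchIn)
import Data.Fin.Properties as Fin
open import Data.Integer.Base using (+_)
open import Data.List.Base using (lookup)
open import Data.List.Membership.Propositional.Properties
  using (∈-filter⁺; ∈-cartesianProduct⁺; ∈-allFin)
open import Data.List.Relation.Unary.Any using (index)
open import Data.List.Relation.Unary.Any.Properties using (lookup-index)
open import Data.Nat.Base as ℕ using (ℕ; zero; suc; s≤s)
import Data.Nat.Properties as ℕ
open import Data.Product.Base using (∃-syntax; _×_; _,_; proj₁; proj₂)
open import Data.Product.Properties using (,-injective)
open import Data.Rational.Base as ℚ using (ℚ; 0ℚ; 1ℚ; ½)
import Data.Rational.Properties as ℚ
open import Data.Rational.Solver using (module +-*-Solver)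
open import Data.Sum.Base using (_⊎_; inj₁; inj₂)
open import Data.Vec.Functional using (Vector; insertAt; removeAt; tail)
open import Data.Vec.Functional.Properties using (insertAt-lookup; insertAt-punchIn)
open import Function.Base using (_∘_; id; const)
open import Function.Definitions using (Injective)
open import Level using (0ℓ)
open import Relation.Binary.Definitions using (tri<; tri≈; tri>)
open import Relation.Binary.PropositionalEquality as ≡ using (_≡_; _≢_)
open import Relation.Nullary using (¬_; contradiction; yes; no; does)
open import Relation.Nullary.Decidable using (decidable-stable; dec-true; dec-false; from-no)
open import Relation.Unary using (Pred)

-- Linear and affine independence over a commutative ring.

module _ (R : CommutativeRing 0ℓ 0ℓ) where

  open CommutativeRing R hiding (zero)

  -- `_#0` plays the part of apartness from zero: `cancel` stands in for inverting a pivot, and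
  -- `tight` for deciding whether an entry is zero.
  module LinearIndependence
    (_#0 : Pred Carrier 0ℓ)
    (tight : ∀ x → ¬ x #0 → x ≈ 0#)
    (cancel : ∀ x y → x #0 → x * y ≈ 0# → y ≈ 0#)
    (1≉0 : ¬ 1# ≈ 0#)
    where

    open import Algebra.Properties.Ring ring using (-‿distribˡ-*; -‿distribʳ-*)
    open import Algebra.Properties.Semiring.Sum semiring
    open import Relation.Binary.Reasoning.Setoid setoid
    open import Algebra.Solver.Ring.NaturalCoefficients.Default commutativeSemiring
      using (solve; _:=_; _:+_; _:*_)

    sum-0 : ∀ {k} (t : Vector Carrier k) → (∀ j → t j ≈ 0#) → sum t ≈ 0#
    sum-0 {k} t t≈0 = trans (sum-cong-≋ t≈0) (sum-replicate-zero k)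

    sum-single : ∀ {k} (t : Vector Carrier k) i → (∀ j → j ≢ i → t j ≈ 0#) → sum t ≈ t i
    sum-single {suc k} t i t≈0 = begin
      sum t                      ≈⟨ sum-remove {i = i} t ⟩
      t i + sum (removeAt t i)   ≈⟨ +-congˡ (sum-0 _ (λ j → t≈0 _ (Fin.punchInᵢ≢i i j))) ⟩
      t i + 0#                   ≈⟨ +-identityʳ (t i) ⟩
      t i                        ∎

    Annihilates : ∀ {m k} → Vector Carrier k → Vector (Vector Carrier m) k → Set
    Annihilates w p = ∀ i → sum (λ j → w j * p j i) ≈ 0#

    LinearlyIndependent : ∀ {m k} → Vector (Vector Carrier m) k → Set
    LinearlyIndependent p = ∀ w → Annihilates w p → ∀ j → w j ≈ 0#

    AffinelyIndependent : ∀ {m k} → Vector (Vector Carrier m) k → Set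
    AffinelyIndependent p = ∀ w → sum w ≈ 0# → Annihilates w p → ∀ j → w j ≈ 0#

    -- Fraction-free Gaussian elimination of coordinate zero with pivot vector j₀:
    -- nothing is divided by the pivot entry, so independence survives as soon as
    -- that entry can be cancelled.
    eliminate : ∀ {m k} → Vector (Vector Carrier (suc m)) (suc k) → Fin (suc k) →
                Vector (Vector Carrier (suc m)) k
    eliminate p j₀ g i = p j₀ zero * p (punchIn j₀ g) i - p (punchIn j₀ g) zero * p j₀ i

    module _ {m k} (p : Vector (Vector Carrier (suc m)) (suc k)) (j₀ : Fin (suc k))
             (w : Vector Carrier k) where

      private
        a = p j₀ zero
        s = sum (λ g → w g * p (punchIn j₀ g) zero)

      -- These are the coefficients of the original vectors after expanding the combination of
      -- eliminated vectors: each remaining vector collects `a * w g`, and the pivot vector collects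
      -- `- s`.
      lift : Vector Carrier (suc k)
      lift = insertAt (λ g → a * w g) j₀ (- s)

      lift-combination : ∀ i →
        sum (λ j → lift j * p j i) ≈ sum (λ g → w g * eliminate p j₀ g i)
      lift-combination i = begin
        sum (λ j → lift j * p j i)
          ≈⟨ sum-remove {i = j₀} (λ j → lift j * p j i) ⟩
        lift j₀ * z + sum (λ g → lift (punchIn j₀ g) * x g)
          ≈⟨ +-cong
               (*-congʳ (reflexive (insertAt-lookup (λ g → a * w g) j₀ (- s))))
               (sum-cong-≋ (λ g → *-congʳ
                 (reflexive (insertAt-punchIn (λ g → a * w g) j₀ (- s) g)))) ⟩
        - s * z + sum (λ g → (a * w g) * x g)
          ≈⟨ +-congʳ (trans (sym (-‿distribˡ-* s z)) (-‿distribʳ-* s z)) ⟩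
        s * - z + sum (λ g → (a * w g) * x g)
          ≈⟨ +-congʳ (*-distribʳ-sum (- z) (λ g → w g * y g)) ⟩
        sum (λ g → (w g * y g) * - z) + sum (λ g → (a * w g) * x g)
          ≈⟨ ∑-distrib-+ (λ g → (w g * y g) * - z) (λ g → (a * w g) * x g) ⟨
        sum (λ g → (w g * y g) * - z + (a * w g) * x g)
          -- The solver works in commutative semirings, so `- z` enters as an atom.
          ≈⟨ sum-cong-≋ (λ g → solve 5
               (λ a w x y z → (w :* y) :* z :+ (a :* w) :* x := w :* (a :* x :+ y :* z))
               refl a (w g) (x g) (y g) (- z)) ⟩
        sum (λ g → w g * (a * x g + y g * - z))
          ≈⟨ sum-cong-≋ (λ g → *-congˡ (+-congˡ (-‿distribʳ-* (y g) z))) ⟨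
        sum (λ g → w g * eliminate p j₀ g i) ∎
        where
        z = p j₀ i
        x y : Fin k → Carrier
        x g = p (punchIn j₀ g) i
        y g = p (punchIn j₀ g) zero

    -- Coordinate zero of every eliminated vector vanishes, so a relation among the tails is one
    -- among the full eliminated vectors, and `lift` turns it into a relation among `p`.
    -- Independence then gives `a * w g ≈ 0#` with `a` the pivot entry, which is cancelled.
    eliminate-independent : ∀ {m k} (p : Vector (Vector Carrier (suc m)) (suc k)) j₀ →
      p j₀ zero #0 → LinearlyIndependent p →
      LinearlyIndependent (λ g → tail (eliminate p j₀ g))
    eliminate-independent {k = k} p j₀ a#0 indep w ann g =
      cancel (p j₀ zero) (w g) a#0
        (trans (reflexive (≡.sym (insertAt-punchIn _ j₀ _ g)))
               (indep (lift p j₀ w) lifted (punchIn j₀ g)))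
      where
      eliminated : ∀ g → eliminate p j₀ g zero ≈ 0#
      eliminated g = trans (+-congʳ (*-comm _ _)) (-‿inverseʳ _)
      lifted : Annihilates (lift p j₀ w) p
      lifted zero    = trans (lift-combination p j₀ w zero)
        (sum-0 _ (λ g → trans (*-congˡ (eliminated g)) (zeroʳ (w g))))
      lifted (suc i) = trans (lift-combination p j₀ w (suc i)) (ann i)

    -- Induction on the dimension, assuming the goal fails. An entry of coordinate zero apart from
    -- zero would be a pivot, and elimination would prove the goal; hence by `tight` all these
    -- entries vanish. Coordinate zero then imposes no condition on relations, so the tails are
    -- still independent and the bound in dimension `m` applies to all `suc k` of them.
    independent⇒≤ : ∀ {m k} (p : Vector (Vector Carrier m) k) → LinearlyIndependent p → k ℕ.≤ m
    independent⇒≤ {k = zero}           p indep = ℕ.z≤n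
    independent⇒≤ {zero}  {suc k}      p indep =
      contradiction (indep (λ _ → 1#) (λ ()) zero) 1≉0
    independent⇒≤ {suc m} {suc k}      p indep =
      decidable-stable (suc k ℕ.≤? suc m) λ k≰m →
        k≰m (ℕ.m≤n⇒m≤1+n (independent⇒≤ (λ j → tail (p j)) (λ w ann →
          indep w λ where
            zero    → sum-0 _ (λ j → trans
              (*-congˡ (tight _ (λ a#0 → k≰m (ℕ.s≤s (independent⇒≤ _ (eliminate-independent p j a#0 indep))))))
              (zeroʳ (w j)))
            (suc i) → ann i)))

    -- The constant coordinate makes the condition on the sum of the coefficients one more linear
    -- equation.
    homogenise : ∀ {m k} → Vector (Vector Carrier m) k → Vector (Vector Carrier (suc m)) k
    homogenise p j zero    = 1#
    homogenise p j (suc i) = p j i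

    affinelyIndependent⇒≤ : ∀ {m k} (p : Vector (Vector Carrier m) k) →
      AffinelyIndependent p → k ℕ.≤ suc m
    affinelyIndependent⇒≤ p indep = independent⇒≤ (homogenise p) λ w ann →
      indep w (trans (sum-cong-≋ (λ j → sym (*-identityʳ (w j)))) (ann zero)) (ann ∘ suc)

    -- Coordinate `i` takes the place of the constant coordinate of `homogenise`, so the vectors are
    -- already linearly independent in dimension `m`.
    coordinate≈1⇒≤ : ∀ {m k} (p : Vector (Vector Carrier m) k) i →
      (∀ j → p j i ≈ 1#) → AffinelyIndependent p → k ℕ.≤ m
    coordinate≈1⇒≤ p i pᵢ≈1 indep = independent⇒≤ p λ w ann →
      indep w (trans (sum-cong-≋ (λ j → trans (sym (*-identityʳ (w j))) (*-congˡ (sym (pᵢ≈1 j)))))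
                     (ann i)) ann

    module _ {m k} (p : Vector (Vector Carrier m) (suc k)) (ι : Fin k → Fin m)
             (p≈0 : ∀ g → p (suc g) (ι g) ≈ 0#)
             (p≈1 : ∀ g j → j ≢ suc g → p j (ι g) ≈ 1#) where

      -- Coordinate `ι g` of the combination is the sum of all coefficients except `w (suc g)`. Both
      -- it and the full sum vanish, hence so does `w (suc g)`; the full sum then leaves only
      -- `w zero`.
      complemented-units-independent : AffinelyIndependent p
      complemented-units-independent w ∑w≈0 ann = λ where
          zero    → begin
            w zero                ≈⟨ +-identityʳ (w zero) ⟨
            w zero + 0#           ≈⟨ +-congˡ (sum-0 (tail w) w≈0) ⟨
            sum w                 ≈⟨ ∑w≈0 ⟩
            0#                    ∎
          (suc g) → w≈0 g
        where
        rest≈0 : ∀ g → sum (removeAt w (suc g)) ≈ 0#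
        rest≈0 g = begin
          sum (removeAt w (suc g))
            ≈⟨ sum-cong-≋ (λ j → trans (sym (*-identityʳ _))
                 (*-congˡ (sym (p≈1 g _ (Fin.punchInᵢ≢i (suc g) j))))) ⟩
          sum (removeAt (λ j → w j * p j (ι g)) (suc g))
            ≈⟨ +-identityˡ _ ⟨
          0# + sum (removeAt (λ j → w j * p j (ι g)) (suc g))
            ≈⟨ +-congʳ (trans (*-congˡ (p≈0 g)) (zeroʳ _)) ⟨
          w (suc g) * p (suc g) (ι g) + sum (removeAt (λ j → w j * p j (ι g)) (suc g))
            ≈⟨ sum-remove {i = suc g} (λ j → w j * p j (ι g)) ⟨
          sum (λ j → w j * p j (ι g))
            ≈⟨ ann (ι g) ⟩
          0# ∎
        w≈0 : ∀ g → w (suc g) ≈ 0#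
        w≈0 g = begin
          w (suc g)                              ≈⟨ +-identityʳ _ ⟨
          w (suc g) + 0#                         ≈⟨ +-congˡ (rest≈0 g) ⟨
          w (suc g) + sum (removeAt w (suc g))   ≈⟨ sum-remove {i = suc g} w ⟨
          sum w                                  ≈⟨ ∑w≈0 ⟩
          0#                                     ∎

open import Defs
open +-*-Solver using (_:=_; _:+_; :-_; _:-_) renaming (solve to ℚ-solve)

-- The commutative ring of Cauchy reals.

p≤∣p∣ : ∀ p → p ℚ.≤ ℚ.∣ p ∣
p≤∣p∣ p with ℚ.≤-total 0ℚ p
... | inj₁ 0≤p = ℚ.≤-reflexive (≡.sym (ℚ.0≤p⇒∣p∣≡p 0≤p))
... | inj₂ p≤0 = ℚ.≤-trans p≤0 (ℚ.0≤∣p∣ p)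

∣p-q∣≡∣q-p∣ : ∀ p q → ℚ.∣ p ℚ.- q ∣ ≡ ℚ.∣ q ℚ.- p ∣
∣p-q∣≡∣q-p∣ p q = ≡.trans (≡.sym (ℚ.∣-p∣≡∣p∣ (p ℚ.- q)))
  (≡.cong ℚ.∣_∣ (ℚ-solve 2 (λ p q → :- (p :- q) := q :- p) ≡.refl p q))

∣p∣≤∣q∣+∣p-q∣ : ∀ p q → ℚ.∣ p ∣ ℚ.≤ ℚ.∣ q ∣ ℚ.+ ℚ.∣ p ℚ.- q ∣
∣p∣≤∣q∣+∣p-q∣ p q = ≡.subst (λ r → ℚ.∣ r ∣ ℚ.≤ ℚ.∣ q ∣ ℚ.+ ℚ.∣ p ℚ.- q ∣)
  (ℚ-solve 2 (λ p q → q :+ (p :- q) := p) ≡.refl p q) (ℚ.∣p+q∣≤∣p∣+∣q∣ q (p ℚ.- q))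

map-eventually : ∀ {P Q : ℕ → Set} → (∀ n → P n → Q n) → Eventually P → Eventually Q
map-eventually f (N , p) = N , λ n N≤n → f n (p n N≤n)

zip-eventually : ∀ {P Q R : ℕ → Set} → (∀ n → P n → Q n → R n) →
                 Eventually P → Eventually Q → Eventually R
zip-eventually f (M , p) (N , q) = M ℕ.⊔ N , λ n ≤n →
  f n (p n (ℕ.m⊔n≤o⇒m≤o M N ≤n)) (q n (ℕ.m⊔n≤o⇒n≤o M N ≤n))

-- Carries the ring laws over from the rationals term by term. Since `_≈_` mentions the sequences
-- and not their Cauchy proofs, the real numbers are explicit arguments.
≗⇒≈ : ∀ x y → (∀ n → seq x n ≡ seq y n) → x ≈ y
≗⇒≈ x y x≗y ε ε>0 = 0 , λ n _ → begin
  ℚ.∣ seq x n ℚ.- seq y n ∣  ≡⟨ ≡.cong (λ q → ℚ.∣ q ℚ.- seq y n ∣) (x≗y n) ⟩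
  ℚ.∣ seq y n ℚ.- seq y n ∣  ≡⟨ ≡.cong ℚ.∣_∣ (ℚ.+-inverseʳ (seq y n)) ⟩
  0ℚ                         <⟨ ε>0 ⟩
  ε                          ∎
  where open ℚ.≤-Reasoning

≈-refl : ∀ x → x ≈ x
≈-refl x = ≗⇒≈ x x (λ _ → ≡.refl)

≈-sym : ∀ x y → x ≈ y → y ≈ x
≈-sym x y x≈y ε ε>0 =
  map-eventually (λ n → ≡.subst (ℚ._≤ ε) (∣p-q∣≡∣q-p∣ (seq x n) (seq y n))) (x≈y ε ε>0)

≈-trans : ∀ x y z → x ≈ y → y ≈ z → x ≈ z
≈-trans x y z x≈y y≈z ε ε>0 = zip-eventually
  (λ n p q → begin
    ℚ.∣ seq x n ℚ.- seq z n ∣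
      ≡⟨ ≡.cong ℚ.∣_∣ (ℚ-solve 3 (λ x y z → x :- z := (x :- y) :+ (y :- z)) ≡.refl (seq x n) (seq y n) (seq z n)) ⟩
    ℚ.∣ (seq x n ℚ.- seq y n) ℚ.+ (seq y n ℚ.- seq z n) ∣
      ≤⟨ ℚ.∣p+q∣≤∣p∣+∣q∣ (seq x n ℚ.- seq y n) _ ⟩
    ℚ.∣ seq x n ℚ.- seq y n ∣ ℚ.+ ℚ.∣ seq y n ℚ.- seq z n ∣
      ≤⟨ ℚ.+-mono-≤ p q ⟩
    ½ ℚ.* ε ℚ.+ ½ ℚ.* ε
      ≡⟨ half ε ⟩
    ε ∎)
  (x≈y _ (half-pos ε ε>0)) (y≈z _ (half-pos ε ε>0))
  where open ℚ.≤-Reasoning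

+-cong : ∀ x y u v → x ≈ y → u ≈ v → x + u ≈ y + v
+-cong x y u v x≈y u≈v ε ε>0 = zip-eventually
  (λ n p q → begin
    ℚ.∣ (seq x n ℚ.+ seq u n) ℚ.- (seq y n ℚ.+ seq v n) ∣
      ≡⟨ ≡.cong ℚ.∣_∣ (ℚ-solve 4 (λ x y u v → (x :+ u) :- (y :+ v) := (x :- y) :+ (u :- v)) ≡.refl
           (seq x n) (seq y n) (seq u n) (seq v n)) ⟩
    ℚ.∣ (seq x n ℚ.- seq y n) ℚ.+ (seq u n ℚ.- seq v n) ∣
      ≤⟨ ℚ.∣p+q∣≤∣p∣+∣q∣ (seq x n ℚ.- seq y n) _ ⟩
    ℚ.∣ seq x n ℚ.- seq y n ∣ ℚ.+ ℚ.∣ seq u n ℚ.- seq v n ∣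
      ≤⟨ ℚ.+-mono-≤ p q ⟩
    ½ ℚ.* ε ℚ.+ ½ ℚ.* ε
      ≡⟨ half ε ⟩
    ε ∎)
  (x≈y _ (half-pos ε ε>0)) (u≈v _ (half-pos ε ε>0))
  where open ℚ.≤-Reasoning

-- From xu - yv = x(u - v) + v(x - y): it suffices to bound `x` and `v` eventually by `A` and `B`
-- and to use the tolerance ε/(A + B) for both differences.
*-cong : ∀ x y u v → x ≈ y → u ≈ v → x * u ≈ y * v
*-cong x y u v x≈y u≈v ε ε>0 =
  let A , A>0 , x≤A = cauchy⇒bounded (seq x) (cauchy x)
      B , B>0 , v≤B = cauchy⇒bounded (seq v) (cauchy v)
      δ , δ>0 , [A+B]δ≡ε = quotient (A ℚ.+ B) ε (ℚ.+-mono-< A>0 B>0) ε>0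
  in zip-eventually
       (λ n (x≤A , v≤B) (x-y , u-v) →
         ≡.subst (ℚ.∣ seq x n ℚ.* seq u n ℚ.- seq y n ℚ.* seq v n ∣ ℚ.≤_) [A+B]δ≡ε
           (*-estimate (seq x n) (seq u n) (seq y n) (seq v n) A B δ A>0 B>0 x≤A v≤B x-y u-v))
       (zip-eventually (λ _ → _,_) x≤A v≤B)
       (zip-eventually (λ _ → _,_) (x≈y δ δ>0) (u≈v δ δ>0))

-- As a product with a constant, negation inherits its Cauchy proof and its congruence from
-- multiplication.
neg : ℝ → ℝ
neg x = fromℚ (ℚ.- 1ℚ) * x

ℝ-commutativeRing : CommutativeRing 0ℓ 0ℓ
ℝ-commutativeRing = record
  { Carrier = ℝ ; _≈_ = _≈_ ; _+_ = _+_ ; _*_ = _*_ ; -_ = neg ; 0# = 0ℝ ; 1# = 1ℝ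
  ; isCommutativeRing = record
    { isRing = record
      { +-isAbelianGroup = record
        { isGroup = record
          { isMonoid = record
            { isSemigroup = record
              { isMagma = record
                { isEquivalence = record
                  { refl  = λ {x} → ≈-refl x
                  ; sym   = λ {x} {y} → ≈-sym x y
                  ; trans = λ {x} {y} {z} → ≈-trans x y z
                  }
                ; ∙-cong = λ {x} {y} {u} {v} → +-cong x y u v
                }
              ; assoc = λ x y z → ≗⇒≈ (x + y + z) (x + (y + z)) (λ n → ℚ.+-assoc (seq x n) (seq y n) (seq z n))
              }
            ; identity = (λ x → ≗⇒≈ (0ℝ + x) x (λ _ → ℚ.+-identityˡ _))
                       , (λ x → ≗⇒≈ (x + 0ℝ) x (λ _ → ℚ.+-identityʳ _))
            }
          ; inverse = (λ x → ≗⇒≈ (neg x + x) 0ℝ (λ n → inverseˡ (seq x n)))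
                    , (λ x → ≗⇒≈ (x + neg x) 0ℝ (λ n → inverseʳ (seq x n)))
          ; ⁻¹-cong = λ {x} {y} → *-cong (fromℚ (ℚ.- 1ℚ)) (fromℚ (ℚ.- 1ℚ)) x y
                                    (≈-refl (fromℚ (ℚ.- 1ℚ)))
          }
        ; comm = λ x y → ≗⇒≈ (x + y) (y + x) (λ n → ℚ.+-comm (seq x n) _)
        }
      ; *-cong = λ {x} {y} {u} {v} → *-cong x y u v
      ; *-assoc = λ x y z → ≗⇒≈ (x * y * z) (x * (y * z)) (λ n → ℚ.*-assoc (seq x n) _ _)
      ; *-identity = (λ x → ≗⇒≈ (1ℝ * x) x (λ _ → ℚ.*-identityˡ _))
                   , (λ x → ≗⇒≈ (x * 1ℝ) x (λ _ → ℚ.*-identityʳ _))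
      ; distrib = (λ x y z → ≗⇒≈ (x * (y + z)) (x * y + x * z)
                               (λ n → ℚ.*-distribˡ-+ (seq x n) (seq y n) (seq z n)))
                , (λ x y z → ≗⇒≈ ((y + z) * x) (y * x + z * x)
                               (λ n → ℚ.*-distribʳ-+ (seq x n) (seq y n) (seq z n)))
      }
    ; *-comm = λ x y → ≗⇒≈ (x * y) (y * x) (λ n → ℚ.*-comm (seq x n) _)
    }
  }
  where
  inverseˡ : ∀ q → (ℚ.- 1ℚ) ℚ.* q ℚ.+ q ≡ 0ℚ
  inverseˡ q = ≡.trans (≡.cong (ℚ._+ q) (≡.trans (≡.sym (ℚ.neg-distribˡ-* 1ℚ q))
                 (≡.cong ℚ.-_ (ℚ.*-identityˡ q)))) (ℚ.+-inverseˡ q)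
  inverseʳ : ∀ q → q ℚ.+ (ℚ.- 1ℚ) ℚ.* q ≡ 0ℚ
  inverseʳ q = ≡.trans (ℚ.+-comm q _) (inverseˡ q)

-- Apartness from zero.

_#0 : Pred ℝ 0ℓ
x #0 = ∃[ δ ] (0ℚ ℚ.< δ × Eventually (λ n → δ ℚ.≤ ℚ.∣ seq x n ∣))

-- Take `N` beyond which terms differ by at most ε/4 and compare the rational `∣ seq x N ∣` with
-- ε/2. If it is larger, all later terms stay at least ε/4 away from zero, which `¬x#0` excludes;
-- otherwise they stay within 3ε/4 of zero.
#0-tight : ∀ x → ¬ x #0 → x ≈ 0ℝ
#0-tight x ¬x#0 ε ε>0 with cauchy x (½ ℚ.* (½ ℚ.* ε)) (half-pos _ (half-pos ε ε>0))
... | N , near = N , λ n N≤n → begin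
  ℚ.∣ seq x n ℚ.- 0ℚ ∣                           ≡⟨ ≡.cong ℚ.∣_∣ (ℚ.+-identityʳ _) ⟩
  ℚ.∣ seq x n ∣                                  ≤⟨ ∣p∣≤∣q∣+∣p-q∣ (seq x n) (seq x N) ⟩
  ℚ.∣ seq x N ∣ ℚ.+ ℚ.∣ seq x n ℚ.- seq x N ∣    ≤⟨ ℚ.+-mono-≤ xₙ≤ (near n N N≤n ℕ.≤-refl) ⟩
  ½ε ℚ.+ ½ ℚ.* ½ε                                ≤⟨ ℚ.+-monoʳ-≤ ½ε ½*½ε≤½ε ⟩
  ½ε ℚ.+ ½ε                                      ≡⟨ half ε ⟩
  ε                                              ∎
  where
  open ℚ.≤-Reasoning
  ½ε = ½ ℚ.* ε
  ½*½ε≤½ε : ½ ℚ.* ½ε ℚ.≤ ½ε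
  ½*½ε≤½ε = ≡.subst₂ ℚ._≤_ (ℚ.+-identityʳ _) (half ½ε)
    (ℚ.+-monoʳ-≤ (½ ℚ.* ½ε) (ℚ.<⇒≤ (half-pos _ (half-pos ε ε>0))))
  xₙ≤ : ℚ.∣ seq x N ∣ ℚ.≤ ½ε
  xₙ≤ with ℚ.∣ seq x N ∣ ℚ.≤? ½ε
  ... | yes ≤½ε = ≤½ε
  ... | no  ≰½ε = contradiction
    (½ ℚ.* ½ε , half-pos _ (half-pos ε ε>0) , N , far) ¬x#0
    where
    far : ∀ n → N ℕ.≤ n → ½ ℚ.* ½ε ℚ.≤ ℚ.∣ seq x n ∣
    far n N≤n = ≡.subst₂ ℚ._≤_ (cancel (½ ℚ.* ½ε) (½ ℚ.* ½ε)) (cancel ℚ.∣ seq x n ∣ (½ ℚ.* ½ε))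
      (ℚ.+-monoˡ-≤ (ℚ.- (½ ℚ.* ½ε)) (begin
        ½ ℚ.* ½ε ℚ.+ ½ ℚ.* ½ε                          ≡⟨ half ½ε ⟩
        ½ε                                             <⟨ ℚ.≰⇒> ≰½ε ⟩
        ℚ.∣ seq x N ∣                                  ≤⟨ ∣p∣≤∣q∣+∣p-q∣ (seq x N) (seq x n) ⟩
        ℚ.∣ seq x n ∣ ℚ.+ ℚ.∣ seq x N ℚ.- seq x n ∣    ≤⟨ ℚ.+-monoʳ-≤ ℚ.∣ seq x n ∣ (near N n ℕ.≤-refl N≤n) ⟩
        ℚ.∣ seq x n ∣ ℚ.+ ½ ℚ.* ½ε                     ∎))
      where
      cancel : ∀ p q → p ℚ.+ q ℚ.- q ≡ p
      cancel = ℚ-solve 2 (λ p q → p :+ q :- q := p) ≡.refl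

-- With δ an eventual lower bound of the absolute value of `x`, the tolerance δε for the product
-- gives δ∣y∣ ≤ ∣x∣∣y∣ ≤ δε, and δ cancels.
#0-cancel : ∀ x y → x #0 → x * y ≈ 0ℝ → y ≈ 0ℝ
#0-cancel x y (δ , δ>0 , δ≤x) xy≈0 ε ε>0 = zip-eventually
  (λ n δ≤x xy≤ → ℚ.*-cancelˡ-≤-pos δ (begin
    δ ℚ.* ℚ.∣ seq y n ℚ.- 0ℚ ∣               ≡⟨ ≡.cong (λ q → δ ℚ.* ℚ.∣ q ∣) (ℚ.+-identityʳ (seq y n)) ⟩
    δ ℚ.* ℚ.∣ seq y n ∣                      ≤⟨ ℚ.*-monoʳ-≤-nonNeg ℚ.∣ seq y n ∣ {{ℚ.∣-∣-nonNeg (seq y n)}} δ≤x ⟩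
    ℚ.∣ seq x n ∣ ℚ.* ℚ.∣ seq y n ∣          ≡⟨ ℚ.∣p*q∣≡∣p∣*∣q∣ (seq x n) (seq y n) ⟨
    ℚ.∣ seq x n ℚ.* seq y n ∣                ≡⟨ ≡.cong ℚ.∣_∣ (ℚ.+-identityʳ _) ⟨
    ℚ.∣ seq x n ℚ.* seq y n ℚ.- 0ℚ ∣         ≤⟨ xy≤ ⟩
    δ ℚ.* ε                                  ∎))
  δ≤x
  (xy≈0 (δ ℚ.* ε) (ℚ.positive⁻¹ (δ ℚ.* ε) {{ℚ.pos*pos⇒pos δ ε {{ℚ.positive ε>0}}}}))
  where
  open ℚ.≤-Reasoning
  instance
    δ-positive : ℚ.Positive δ
    δ-positive = ℚ.positive δ>0

1≉0 : ¬ 1ℝ ≈ 0ℝ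
1≉0 1≈0 with 1≈0 ½ (ℚ.positive⁻¹ ½)
... | N , p = contradiction (p N ℕ.≤-refl) (from-no (1ℚ ℚ.≤? ½))

-- The order on the Cauchy reals.

≈⇒≤ : ∀ x y → x ≈ y → x ≤ y
≈⇒≤ x y x≈y ε ε>0 = map-eventually
  (λ n p → begin
    seq x n                             ≡⟨ ℚ-solve 2 (λ x y → x := y :+ (x :- y)) ≡.refl (seq x n) (seq y n) ⟩
    seq y n ℚ.+ (seq x n ℚ.- seq y n)   ≤⟨ ℚ.+-monoʳ-≤ (seq y n) (ℚ.≤-trans (p≤∣p∣ _) p) ⟩
    seq y n ℚ.+ ε                       ∎)
  (x≈y ε ε>0)
  where open ℚ.≤-Reasoning

≤-trans : ∀ x y z → x ≤ y → y ≤ z → x ≤ z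
≤-trans x y z x≤y y≤z ε ε>0 = zip-eventually
  (λ n p q → begin
    seq x n                               ≤⟨ p ⟩
    seq y n ℚ.+ ½ ℚ.* ε                   ≤⟨ ℚ.+-monoˡ-≤ (½ ℚ.* ε) q ⟩
    seq z n ℚ.+ ½ ℚ.* ε ℚ.+ ½ ℚ.* ε       ≡⟨ ℚ.+-assoc (seq z n) _ _ ⟩
    seq z n ℚ.+ (½ ℚ.* ε ℚ.+ ½ ℚ.* ε)     ≡⟨ ≡.cong (seq z n ℚ.+_) (half ε) ⟩
    seq z n ℚ.+ ε                         ∎)
  (x≤y _ (half-pos ε ε>0)) (y≤z _ (half-pos ε ε>0))
  where open ℚ.≤-Reasoning

+-mono-≤ : ∀ x y u v → x ≤ y → u ≤ v → x + u ≤ y + v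
+-mono-≤ x y u v x≤y u≤v ε ε>0 = zip-eventually
  (λ n p q → begin
    seq x n ℚ.+ seq u n                                   ≤⟨ ℚ.+-mono-≤ p q ⟩
    (seq y n ℚ.+ ½ ℚ.* ε) ℚ.+ (seq v n ℚ.+ ½ ℚ.* ε)
      ≡⟨ ℚ-solve 3 (λ y v h → (y :+ h) :+ (v :+ h) := (y :+ v) :+ (h :+ h)) ≡.refl (seq y n) (seq v n) (½ ℚ.* ε) ⟩
    (seq y n ℚ.+ seq v n) ℚ.+ (½ ℚ.* ε ℚ.+ ½ ℚ.* ε)       ≡⟨ ≡.cong (seq y n ℚ.+ seq v n ℚ.+_) (half ε) ⟩
    seq y n ℚ.+ seq v n ℚ.+ ε                             ∎)
  (x≤y _ (half-pos ε ε>0)) (u≤v _ (half-pos ε ε>0))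
  where open ℚ.≤-Reasoning

sum-mono-≤ : ∀ {k} (s t : Vector ℝ k) → (∀ j → s j ≤ t j) → sum s ≤ sum t
sum-mono-≤ {zero}  s t s≤t = ≈⇒≤ 0ℝ 0ℝ (≈-refl 0ℝ)
sum-mono-≤ {suc k} s t s≤t =
  +-mono-≤ (s zero) (t zero) (sum (s ∘ suc)) (sum (t ∘ suc)) (s≤t zero)
    (sum-mono-≤ (s ∘ suc) (t ∘ suc) (s≤t ∘ suc))

open LinearIndependence ℝ-commutativeRing _#0 #0-tight #0-cancel 1≉0
  hiding (AffinelyIndependent)

-- Convex hulls of sets of 0/1 points containing 𝟙 and every 𝟙 - e_g.

allBut : ∀ {m} → Fin m → Vector Bool m
allBut g h = not (does (g Fin.≟ h))

allBut-≡ : ∀ {m} (g : Fin m) → allBut g g ≡ false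
allBut-≡ g = ≡.cong not (dec-true (g Fin.≟ g) ≡.refl)

allBut-≢ : ∀ {m} {g h : Fin m} → g ≢ h → allBut g h ≡ true
allBut-≢ {g = g} {h} g≢h = ≡.cong not (dec-false (g Fin.≟ h) g≢h)

allBut-false : ∀ {m} (g h : Fin m) → allBut g h ≡ false → g ≡ h
allBut-false g h eq with g Fin.≟ h
... | yes g≡h = g≡h

bit-cong : ∀ {b c} → b ≡ c → bit b ≈ bit c
bit-cong {b} ≡.refl = ≈-refl (bit b)

⟨unit,⟩ : ∀ {m} (f : Fin m) x → ⟨ unit f , x ⟩ ≈ x f
⟨unit,⟩ f x = ≈-trans ⟨ unit f , x ⟩ (unit f f * x f) (x f)
  (sum-single (λ i → unit f i * x i) f (λ i i≢f →
    ≈-trans (unit f i * x i) (0ℝ * x i) 0ℝ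
      (*-cong (unit f i) 0ℝ (x i) (x i) (bit-cong (dec-false (f Fin.≟ i) (i≢f ∘ ≡.sym))) (≈-refl (x i)))
      (zeroˡ (x i))))
  (≈-trans (unit f f * x f) (1ℝ * x f) (x f)
    (*-cong (unit f f) 1ℝ (x f) (x f) (bit-cong (dec-true (f Fin.≟ f) ≡.refl)) (≈-refl (x f)))
    (*-identityˡ (x f)))
  where open CommutativeRing ℝ-commutativeRing using (zeroˡ; *-identityˡ)

hyperplane⁺ : ∀ {m} (f : Fin m) x → x f ≈ 1ℝ → Hyperplane (unit f) 1ℝ x
hyperplane⁺ f x = ≈-trans ⟨ unit f , x ⟩ (x f) 1ℝ (⟨unit,⟩ f x)

hyperplane⁻ : ∀ {m} (f : Fin m) x → Hyperplane (unit f) 1ℝ x → x f ≈ 1ℝ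
hyperplane⁻ f x = ≈-trans (x f) ⟨ unit f , x ⟩ 1ℝ (≈-sym ⟨ unit f , x ⟩ (x f) (⟨unit,⟩ f x))

⊆conv : ∀ {m} (S : Pred (ℝ^ m) 0ℓ) x → S x → conv S x
⊆conv S x x∈S =
  1 , const 1ℝ , const x , const x∈S , const 0≤1 , +-identityʳ 1ℝ ,
  λ i → ≈-sym (1ℝ * x i + 0ℝ) (x i)
    (≈-trans (1ℝ * x i + 0ℝ) (1ℝ * x i) (x i) (+-identityʳ (1ℝ * x i)) (*-identityˡ (x i)))
  where
  open CommutativeRing ℝ-commutativeRing using (+-identityʳ; *-identityˡ)
  0≤1 : 0ℝ ≤ 1ℝ
  0≤1 ε ε>0 = 0 , λ _ _ → ℚ.<⇒≤ (ℚ.+-mono-< (ℚ.positive⁻¹ 1ℚ) ε>0)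

module _ {m} (S : Pred (ℝ^ m) 0ℓ)
         (bits : ∀ x → S x → ∀ i → ∃[ b ] x i ≈ bit b) where

  -- The coordinate is a sum of terms `w j * p j i`. As `p j i` is a bit, each term equals `w j` or
  -- zero, hence is at most `w j`, and the weights sum to one.
  conv-coordinate≤1 : ∀ x → conv S x → ∀ i → x i ≤ 1ℝ
  conv-coordinate≤1 x (k , w , p , p∈S , 0≤w , ∑w≈1 , x≋) i =
    ≤-trans (x i) (sum w) 1ℝ
      (≤-trans (x i) (linComb w p i) (sum w) (≈⇒≤ (x i) (linComb w p i) (x≋ i))
        (sum-mono-≤ (λ j → w j * p j i) w λ j → term≤ j (bits (p j) (p∈S j) i)))
      (≈⇒≤ (sum w) 1ℝ ∑w≈1)
    where
    open CommutativeRing ℝ-commutativeRing using (*-identityʳ; zeroʳ)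
    term≤ : ∀ j → ∃[ b ] p j i ≈ bit b → w j * p j i ≤ w j
    term≤ j (true , p≈1) = ≈⇒≤ (w j * p j i) (w j)
      (≈-trans (w j * p j i) (w j * 1ℝ) (w j)
        (*-cong (w j) (w j) (p j i) 1ℝ (≈-refl (w j)) p≈1) (*-identityʳ (w j)))
    term≤ j (false , p≈0) = ≤-trans (w j * p j i) 0ℝ (w j)
      (≈⇒≤ (w j * p j i) 0ℝ
        (≈-trans (w j * p j i) (w j * 0ℝ) 0ℝ
          (*-cong (w j) (w j) (p j i) 0ℝ (≈-refl (w j)) p≈0) (zeroʳ (w j))))
      (0≤w j)

-- Stated for a variable p: at a concrete family, the conversion between the two
-- notions of affine independence unfolds the sums and is prohibitively slow.
ℝ-complemented-units-independent : ∀ {m k} (p : Vector (ℝ^ m) (suc k)) (ι : Fin k → Fin m) →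
  (∀ g → p (suc g) (ι g) ≈ 0ℝ) → (∀ g j → j ≢ suc g → p j (ι g) ≈ 1ℝ) →
  AffinelyIndependent p
ℝ-complemented-units-independent = complemented-units-independent

-- The map `ι` selects which points 𝟙 - e_g occur, so that one family serves both counts: `id` for
-- the whole hull and `punchIn f` for the face x_f = 1.
𝟙-and-allBut : ∀ {m k} → (Fin k → Fin m) → Vector (ℝ^ m) (suc k)
𝟙-and-allBut ι zero    = bit ∘ const true
𝟙-and-allBut ι (suc g) = bit ∘ allBut (ι g)

-- Injectivity ensures that coordinate `ι g` is zero at the point `suc g` only.
𝟙-and-allBut-independent : ∀ {m k} (ι : Fin k → Fin m) → Injective _≡_ _≡_ ι →
  AffinelyIndependent (𝟙-and-allBut ι)
𝟙-and-allBut-independent ι ι-injective =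
  ℝ-complemented-units-independent (𝟙-and-allBut ι) ι at≈0 elsewhere≈1
  where
  at≈0 : ∀ g → 𝟙-and-allBut ι (suc g) (ι g) ≈ 0ℝ
  at≈0 g = bit-cong (allBut-≡ (ι g))
  elsewhere≈1 : ∀ g j → j ≢ suc g → 𝟙-and-allBut ι j (ι g) ≈ 1ℝ
  elsewhere≈1 g zero    _   = ≈-refl 1ℝ
  elsewhere≈1 g (suc h) h≢g = bit-cong (allBut-≢ (h≢g ∘ ≡.cong suc ∘ ι-injective))

module _ {m} (S : Pred (ℝ^ m) 0ℓ)
         (𝟙∈S : S (bit ∘ const true)) (allBut∈S : ∀ g → S (bit ∘ allBut g)) where

  𝟙-and-allBut∈conv : ∀ {k} (ι : Fin k → Fin m) j → conv S (𝟙-and-allBut ι j)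
  𝟙-and-allBut∈conv ι zero    = ⊆conv S (bit ∘ const true) 𝟙∈S
  𝟙-and-allBut∈conv ι (suc g) = ⊆conv S (bit ∘ allBut (ι g)) (allBut∈S (ι g))

  conv-fullDimensional : FullDimensional (conv S)
  conv-fullDimensional =
    -- The witness counts points, one more than the dimension: `suc m ⊖ 1` reduces to `+ m`.
    suc m , ≡.refl ,
    (𝟙-and-allBut id , 𝟙-and-allBut∈conv id , 𝟙-and-allBut-independent id id) ,
    λ k (p , _ , independent) → affinelyIndependent⇒≤ p independent

coordinate≤1-facet : ∀ {m} (S : Pred (ℝ^ m) 0ℓ) →
  (∀ x → S x → ∀ i → ∃[ b ] x i ≈ bit b) →
  S (bit ∘ const true) → (∀ g → S (bit ∘ allBut g)) →
  ∀ f → FacetDefining (conv S) (unit f) 1ℝ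
coordinate≤1-facet {suc m} S bits 𝟙∈S allBut∈S f =
  (λ x x∈ → ≤-trans ⟨ unit f , x ⟩ (x f) 1ℝ (≈⇒≤ ⟨ unit f , x ⟩ (x f) (⟨unit,⟩ f x))
    (conv-coordinate≤1 S bits x x∈ f)) ,
  + suc m , conv-fullDimensional S 𝟙∈S allBut∈S ,
  -- The ambient dimension is now `suc m`, so the hull has `suc (suc m)` independent points. The
  -- face has one fewer, because `punchIn f` skips exactly 𝟙 - e_f.
  suc m , ≡.refl ,
  (𝟙-and-allBut (punchIn f) ,
    (λ j → 𝟙-and-allBut∈conv S 𝟙∈S allBut∈S (punchIn f) j ,
           hyperplane⁺ f (𝟙-and-allBut (punchIn f) j) (coordinate-f j)) ,
    𝟙-and-allBut-independent (punchIn f) (Fin.punchIn-injective f _ _)) ,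
  λ k (p , p∈ , independent) →
    coordinate≈1⇒≤ p f (λ j → hyperplane⁻ f (p j) (proj₂ (p∈ j))) independent
  where
  coordinate-f : ∀ j → 𝟙-and-allBut (punchIn f) j f ≈ 1ℝ
  coordinate-f zero    = ≈-refl 1ℝ
  coordinate-f (suc g) = bit-cong (allBut-≢ (Fin.punchInᵢ≢i f g))

-- Chordal completions missing at most one pair.

module _ {n} (G : Graph n) where

  open Graph

  nonEdge⇒index : ∀ {u v} → NonEdge G (u , v) → ∃[ f ] lookup (Eᶜ G) f ≡ (u , v)
  nonEdge⇒index {u} {v} uv∉E = index uv∈ , ≡.sym (lookup-index uv∈)
    where uv∈ = ∈-filter⁺ (nonEdge? G) (∈-cartesianProduct⁺ (∈-allFin u) (∈-allFin v)) uv∉E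

  -- `Eᶜ` lists each pair in increasing order only, so the order of `u` and `v` decides which
  -- alternative of `Ends` holds.
  ends-of-nonEdge : ∀ {u v} → u ≢ v → ¬ Adj G u v → ∃[ f ] Ends G f u v
  ends-of-nonEdge {u} {v} u≢v uv∉E with Fin.<-cmp u v
  ... | tri< u<v _ _ = let f , eq = nonEdge⇒index (u<v , uv∉E) in f , inj₁ eq
  ... | tri≈ _ u≡v _ = contradiction u≡v u≢v
  ... | tri> _ _ v<u = let f , eq = nonEdge⇒index (v<u , uv∉E ∘ symm G) in f , inj₂ eq

  missing-edge : ∀ x {u v} → u ≢ v → ¬ Adj (fill G x) u v → ∃[ f ] (x f ≡ false × Ends G f u v)
  missing-edge x u≢v uv∉ with ends-of-nonEdge u≢v (uv∉ ∘ inj₁)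
  ... | f , ends = f , Bool.¬-not (λ xf → uv∉ (inj₂ (f , xf , ends))) , ends

  -- A position determines its two ends up to order. This forces two diagonals of a cycle recorded
  -- at the same position to share a vertex.
  ends-meet : ∀ f {u v u′ v′} → Ends G f u v → Ends G f u′ v′ → u ≡ u′ ⊎ u ≡ v′
  ends-meet f (inj₁ e) (inj₁ e′) = inj₁ (proj₁ (,-injective (≡.trans (≡.sym e) e′)))
  ends-meet f (inj₁ e) (inj₂ e′) = inj₂ (proj₁ (,-injective (≡.trans (≡.sym e) e′)))
  ends-meet f (inj₂ e) (inj₁ e′) = inj₂ (proj₂ (,-injective (≡.trans (≡.sym e) e′)))
  ends-meet f (inj₂ e) (inj₂ e′) = inj₁ (proj₂ (,-injective (≡.trans (≡.sym e) e′)))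

  -- The disjoint pairs c₀c₂ and c₁c₃ of a cycle cannot both be the one missing edge.
  fill-chordal : ∀ x → (∀ f g → x f ≡ false → x g ≡ false → f ≡ g) → Chordal (fill G x)
  -- The implicit argument is one less than the number of vertices, so this cycle has `4 + k` of
  -- them.
  fill-chordal x unique {suc (suc (suc k))} c _ (_ , c-injective , _)
    with adj? (fill G x) (c zero) (c (suc (suc zero)))
       | adj? (fill G x) (c (suc zero)) (c (suc (suc (suc zero))))
  ... | yes c₀c₂ | _ = zero , suc (suc zero) , (λ { (inj₁ ()) ; (inj₂ ()) }) , c₀c₂
  ... | no _ | yes c₁c₃ = suc zero , suc (suc (suc zero)) , not-consecutive k , c₁c₃
    where
    -- The successor of vertex 3 wraps around to 0 in a cycle of length four and is 4 in a longer
    -- one; neither is vertex 1, but seeing this takes a split on `k`.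
    not-consecutive : ∀ k → ¬ Consecutive {suc (suc (suc k))} (suc zero) (suc (suc (suc zero)))
    not-consecutive k       (inj₁ ())
    not-consecutive zero    (inj₂ ())
    not-consecutive (suc k) (inj₂ ())
  ... | no c₀c₂ | no c₁c₃
    with missing-edge x (λ eq → Fin.0≢1+n (c-injective eq)) c₀c₂
       | missing-edge x (λ eq → Fin.0≢1+n (Fin.suc-injective (c-injective eq))) c₁c₃
  ... | f , xf , ends-f | g , xg , ends-g with unique f g xf xg
  ... | ≡.refl with ends-meet f ends-f ends-g
  ... | inj₁ eq = contradiction (c-injective eq) Fin.0≢1+n
  ... | inj₂ eq = contradiction (c-injective eq) Fin.0≢1+n
  fill-chordal x unique {zero} c (s≤s ())
  fill-chordal x unique {suc zero} c (s≤s (s≤s ()))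
  fill-chordal x unique {suc (suc zero)} c (s≤s (s≤s (s≤s ())))

  fill∈X : ∀ x → (∀ f g → x f ≡ false → x g ≡ false → f ≡ g) → X G (bit ∘ x)
  fill∈X x unique = x , fill-chordal x unique , λ f → ≈-refl (bit (x f))

  𝟙∈X : X G (bit ∘ const true)
  𝟙∈X = fill∈X (const true) (λ _ _ ())

  allBut∈X : ∀ g → X G (bit ∘ allBut g)
  allBut∈X g = fill∈X (allBut g) λ f h g≢f g≢h →
    ≡.trans (≡.sym (allBut-false g f g≢f)) (allBut-false g h g≢h)

theorem1 : (n : ℕ) (G : Graph n) → ¬ Complete G →
    FullDimensional (conv (X G)) ×
    ((f : Fin (∣Eᶜ∣ G)) → FacetDefining (conv (X G)) (unit f) 1ℝ)
theorem1 n G _ =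
  conv-fullDimensional (X G) (𝟙∈X G) (allBut∈X G) ,
  coordinate≤1-facet (X G) (λ _ (x , _ , y≋x) f → x f , y≋x f) (𝟙∈X G) (allBut∈X G)
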